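{- Let $\theta=p/q\in(0,1]$, where $p,q\in\mathbb{N}$ and $\gcd(p,q)=1$. Let $(a_n)_{n=1}^\infty=\mathcal{G}(\theta)$. Then $$\left(\theta-\sum_{n=1}^{\ell}\frac{1}{a_n}\right)^{ -1}\in\mathbb{N},$$ where $\ell$ is the smallest nonnegative integer such that $p$ divides $q+\ell$. As a result, $$a_{n+1}=a_n^2-a_n+1\quad\text{for all } n\geqslant \ell+1.$$
   Context: $\mathbb{N}$ is the set of positive integers. For $\theta\in(0,1]$ let $G(\theta)=\lfloor 1/\theta\rfloor+1$. The greedy algorithm $\mathcal{G}$ produces the sequence $\mathcal{G}(\theta)=(a_n)_{n=1}^\infty$ of positive integers defined by $a_1=G(\theta)$ and $a_m=G\left(\theta-\sum_{n=1}^{m-1}1/a_n\right)$ for $m\geqslant 2$. An empty sum is $0$. -}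

module Defs where

open import Data.Nat as ℕ using (ℕ; zero; suc)
import Data.Nat.Properties as ℕ
open import Data.Nat.DivMod using (m≡m%n+[m/n]*n; m%n<n)
open import Data.Integer using (+_; +[1+_]; ∣_∣; +<+)
import Data.Integer.Properties as ℤ
open import Data.Product using (_×_)
open import Data.Rational hiding (∣_∣)
import Data.Rational.Unnormalised as ℚᵘ
import Data.Rational.Unnormalised.Properties as ℚᵘ
open import Data.Rational.Properties
open import Relation.Binary.PropositionalEquality

-- Here 1/ θ > 0, so floor (1/ θ) ≥ 0 and ∣_∣ only transports it from ℤ to ℕ.
-- The formula makes sense for every θ > 0; the restriction θ ≤ 1 is a
-- hypothesis wherever the greedy sequence is used.
G : (θ : ℚ) → .{{Positive θ}} → ℕ
G θ = suc ∣ floor ((1/ θ) {{pos⇒nonZero θ}}) ∣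

1/G<θ : (θ : ℚ) .{{_ : Positive θ}} → + 1 / G θ < θ
1/G<θ θ@(mkℚ +[1+ n ] d _) =
  toℚᵘ-cancel-< (ℚᵘ.<-respˡ-≃ (ℚᵘ.≃-sym (toℚᵘ-fromℚᵘ (ℚᵘ.mkℚᵘ (+ 1) g-1)))
    (ℚᵘ.*<* (+<+ (begin-strict
      1 ℕ.* suc d                           ≡⟨ ℕ.*-identityˡ (suc d) ⟩
      suc d                                 ≡⟨ m≡m%n+[m/n]*n (suc d) (suc n) ⟩
      suc d ℕ.% suc n ℕ.+ k ℕ.* suc n       <⟨ ℕ.+-monoˡ-< (k ℕ.* suc n) (m%n<n (suc d) (suc n)) ⟩
      suc k ℕ.* suc n                       ≡⟨ ℕ.*-comm (suc k) (suc n) ⟩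
      suc n ℕ.* suc k                       ≡⟨ cong (λ j → suc n ℕ.* suc j) (sym g-1≡k) ⟩
      suc n ℕ.* suc g-1                     ∎))))
  where
  open ℕ.≤-Reasoning
  k g-1 : ℕ
  k   = suc d ℕ./ suc n
  g-1 = ∣ floor ((1/ θ) {{pos⇒nonZero θ}}) ∣
  g-1≡k : g-1 ≡ k
  g-1≡k = cong ∣_∣ (ℤ.*-identityˡ (+ k))

-- 𝒢 θ n is aₙ, indexed from n = 1, and partialSum θ m is 1/a₁ + ⋯ + 1/aₘ.
-- Mutual recursion carries the proof that every remainder θ - partialSum θ m
-- is positive, so that G may be applied to it.
partialSum : (θ : ℚ) → .{{Positive θ}} → ℕ → ℚ
𝒢 : (θ : ℚ) → .{{Positive θ}} → (n : ℕ) → .{{ℕ.NonZero n}} → ℕ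
𝒢-nonZero : (θ : ℚ) .{{_ : Positive θ}} (n : ℕ) .{{_ : ℕ.NonZero n}} → ℕ.NonZero (𝒢 θ n)
remainder-pos : (θ : ℚ) .{{_ : Positive θ}} (m : ℕ) → Positive (θ - partialSum θ m)

partialSum θ zero    = 0ℚ
partialSum θ (suc m) = partialSum θ m + (+ 1 / 𝒢 θ (suc m)) {{𝒢-nonZero θ (suc m)}}

𝒢 θ (suc m) = G (θ - partialSum θ m) {{remainder-pos θ m}}

𝒢-nonZero θ (suc m) = _

remainder-pos θ zero    = positive (subst (0ℚ <_) (sym (+-identityʳ θ)) (positive⁻¹ θ))
remainder-pos θ (suc m) = positive (subst (0ℚ <_) eq 0<r-u)
  where
  instance
    r>0 : Positive (θ - partialSum θ m)
    r>0 = remainder-pos θ m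
  s r u : ℚ
  s = partialSum θ m
  r = θ - s
  u = + 1 / G r
  0<r-u : 0ℚ < r - u
  0<r-u = subst (_< r - u) (+-inverseʳ u) (+-monoˡ-< (- u) (1/G<θ r))
  eq : r - u ≡ θ - (s + u)
  eq = trans (+-assoc θ (- s) (- u)) (cong (λ x → θ + x) (sym (neg-distrib-+ s u)))

remainder-nonZero : (θ : ℚ) .{{_ : Positive θ}} (m : ℕ) → NonZero (θ - partialSum θ m)
remainder-nonZero θ m = pos⇒nonZero (θ - partialSum θ m) {{remainder-pos θ m}}

IsLeast : (ℕ → Set) → ℕ → Set
IsLeast P ℓ = P ℓ × (∀ j → P j → ℓ ℕ.≤ j)

{-# OPTIONS --safe #-}
-- If r = c/d is in lowest terms then r − 1/G(r) = e/(d G(r)), where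
-- e = c G(r) − d = c − (d mod c).  So the numerator of the remainder strictly
-- decreases at each greedy step until it reaches 1, where it stays.  The first
-- step already brings it down to at most ℓ (when ℓ > 0), since q + e is the
-- first multiple of p beyond q; after ℓ steps it is therefore 1.  From a
-- remainder 1/N one gets aₙ = N + 1, then the remainder 1/(N(N + 1)), and
-- hence aₙ₊₁ = N(N + 1) + 1.
module Submission where

open import Defs
open import Data.Nat as ℕ using (ℕ; zero; suc; pred; z≤n; s≤s)
import Data.Nat.Properties as ℕ
open import Data.Nat.Coprimality using (Coprime; gcd≡1⇒coprime; 1-coprimeTo; recompute)
open import Data.Nat.DivMod using (m≡m%n+[m/n]*n; m%n≤n; m%n<n; m/n*n≤m; n/1≡n)
open import Data.Nat.Divisibility using (_∣_; divides; ∣-refl; ∣⇒≤)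
open import Data.Nat.GCD using (gcd)
open import Data.Nat.Solver using (module +-*-Solver)
open import Data.Integer as ℤ using (+_; +[1+_]; ∣_∣)
import Data.Integer.GCD as ℤ
import Data.Integer.Properties as ℤ
import Data.Integer.Solver as ℤ
open import Data.Rational using (ℚ; mkℚ; Positive; NonZero; 1ℚ; 1/_; _/_; _+_; _-_; -_; _≤_; ↥_; ↧ₙ_; toℚᵘ)
open import Data.Rational.Properties
  using (toℚᵘ-injective; toℚᵘ-homo-+; toℚᵘ-homo‿-; toℚᵘ-fromℚᵘ; ↥-/; normalize-coprime; +-assoc; +-identityʳ; neg-distrib-+)
open import Data.Rational.Unnormalised as ℚᵘ using (mkℚᵘ)
import Data.Rational.Unnormalised.Properties as ℚᵘ
open import Data.Product using (_×_; ∃-syntax; _,_; proj₁; proj₂)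
open import Relation.Binary.PropositionalEquality using (_≡_; refl; sym; trans; cong; subst; module ≡-Reasoning)

G-mkℚ : ∀ n d .(c : Coprime (suc n) (suc d)) → G (mkℚ +[1+ n ] d c) ≡ suc (suc d ℕ./ suc n)
G-mkℚ n d c = cong (λ i → suc ∣ i ∣) (ℤ.*-identityˡ (+ (suc d ℕ./ suc n)))

-- The positivity argument of `G` has a type depending on the rational, so plain `cong` does not
-- apply; being irrelevant, it can be ignored once `r` and `s` are identified.
G-cong : ∀ {r s} .{{_ : Positive r}} .{{_ : Positive s}} → r ≡ s → G r ≡ G s
G-cong refl = refl

1/n≡mkℚ : ∀ d → + 1 / suc d ≡ mkℚ (+ 1) d (1-coprimeTo (suc d))
1/n≡mkℚ d = normalize-coprime (1-coprimeTo (suc d))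

G-unitFraction : ∀ r .{{_ : Positive r}} d → r ≡ + 1 / suc d → G r ≡ suc (suc d)
G-unitFraction r d r≡1/d = begin
  G r                                            ≡⟨ G-cong (trans r≡1/d (1/n≡mkℚ d)) ⟩
  G (mkℚ (+ 1) d (1-coprimeTo (suc d)))          ≡⟨ G-mkℚ 0 d (1-coprimeTo (suc d)) ⟩
  suc (suc d ℕ./ 1)                              ≡⟨ cong suc (n/1≡n (suc d)) ⟩
  suc (suc d)                                    ∎
  where open ≡-Reasoning

-- The distance from `d` to the first multiple of `suc n` strictly beyond it: if `suc n` divides
-- `d`, this is `suc n` and not 0.
excess : ℕ → ℕ → ℕ
excess n d = suc n ℕ.∸ d ℕ.% suc n

multiple≡+excess : ∀ n d → suc n ℕ.* suc (d ℕ./ suc n) ≡ d ℕ.+ excess n d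
multiple≡+excess n d = begin
  c ℕ.* suc k                          ≡⟨ ℕ.*-comm c (suc k) ⟩
  c ℕ.+ k ℕ.* c                        ≡⟨ cong (ℕ._+ k ℕ.* c) (sym (ℕ.m+[n∸m]≡n (m%n≤n d c))) ⟩
  ρ ℕ.+ excess n d ℕ.+ k ℕ.* c         ≡⟨ solve 3 (λ x y z → x :+ y :+ z := x :+ z :+ y) refl ρ (excess n d) (k ℕ.* c) ⟩
  ρ ℕ.+ k ℕ.* c ℕ.+ excess n d         ≡⟨ cong (ℕ._+ excess n d) (sym (m≡m%n+[m/n]*n d c)) ⟩
  d ℕ.+ excess n d                     ∎
  where
  open ≡-Reasoning
  open +-*-Solver
  c = suc n
  k = d ℕ./ suc n
  ρ = d ℕ.% suc n

-- Since `suc l` is positive, `d + suc l` is a multiple of `suc n` strictly beyond `d`, so it cannot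
-- precede the first such multiple.
excess≤ : ∀ n d l → suc n ∣ d ℕ.+ suc l → excess n d ℕ.≤ suc l
excess≤ n d l (divides a eq) = ℕ.+-cancelˡ-≤ d _ _ (begin
  d ℕ.+ excess n d                     ≡⟨ multiple≡+excess n d ⟨
  suc n ℕ.* suc (d ℕ./ suc n)          ≡⟨ ℕ.*-comm (suc n) _ ⟩
  suc (d ℕ./ suc n) ℕ.* suc n          ≤⟨ ℕ.*-monoˡ-≤ (suc n) k<a ⟩
  a ℕ.* suc n                          ≡⟨ eq ⟨
  d ℕ.+ suc l                          ∎)
  where
  open ℕ.≤-Reasoning
  k<a : d ℕ./ suc n ℕ.< a
  k<a = ℕ.*-cancelʳ-< (suc n) _ _ (begin-strict
    d ℕ./ suc n ℕ.* suc n   ≤⟨ m/n*n≤m d (suc n) ⟩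
    d                       <⟨ ℕ.m<m+n d (s≤s z≤n) ⟩
    d ℕ.+ suc l             ≡⟨ eq ⟩
    a ℕ.* suc n             ∎)

coprime-∣⇒≡1 : ∀ {c d} → Coprime c d → c ∣ d → c ≡ 1
coprime-∣⇒≡1 cop c∣d = cop (∣-refl , c∣d)

-- A nonzero residue makes the excess at most `n`, hence at most `l`. Residue 0 means `suc n`
-- divides `d`, and coprimality then forces `suc n` to be 1. The form `suc (pred l)` lets the bound
-- stop at 1.
excess≤-coprime : ∀ n d l → Coprime (suc n) d → suc n ℕ.≤ suc l → excess n d ℕ.≤ suc (pred l)
excess≤-coprime n d l cop n≤l with d ℕ.% suc n in eq
... | suc ρ = ℕ.≤-trans (ℕ.m∸n≤m n ρ) (ℕ.≤-trans (ℕ.s≤s⁻¹ n≤l) (l≤suc[pred[l]] l))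
  where
  l≤suc[pred[l]] : ∀ l → l ℕ.≤ suc (pred l)
  l≤suc[pred[l]] zero    = z≤n
  l≤suc[pred[l]] (suc l) = ℕ.≤-refl
... | zero  = subst (ℕ._≤ suc (pred l)) (sym (coprime-∣⇒≡1 cop (divides (d ℕ./ suc n) d≡))) (s≤s z≤n)
  where
  d≡ : d ≡ d ℕ./ suc n ℕ.* suc n
  d≡ = trans (m≡m%n+[m/n]*n d (suc n)) (cong (ℕ._+ d ℕ./ suc n ℕ.* suc n) eq)

-- The right-hand side need not be in lowest terms. Over unnormalised fractions both sides have the
-- same denominator, and only the numerators have to be compared.
mkℚ-1/g : ∀ n d g e .(cop : Coprime (suc n) (suc d)) → suc n ℕ.* suc g ≡ suc d ℕ.+ e →
          mkℚ +[1+ n ] d cop - + 1 / suc g ≡ + e / (suc d ℕ.* suc g)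
mkℚ-1/g n d g e cop eq = toℚᵘ-injective (begin
  toℚᵘ (r - u)                            ≈⟨ toℚᵘ-homo-+ r (- u) ⟩
  toℚᵘ r ℚᵘ.+ toℚᵘ (- u)                  ≈⟨ ℚᵘ.+-congʳ (toℚᵘ r) (toℚᵘ-homo‿- u) ⟩
  toℚᵘ r ℚᵘ.- toℚᵘ u                      ≈⟨ ℚᵘ.+-congʳ (toℚᵘ r) (ℚᵘ.-‿cong (toℚᵘ-fromℚᵘ (mkℚᵘ (+ 1) g))) ⟩
  mkℚᵘ +[1+ n ] d ℚᵘ.- mkℚᵘ (+ 1) g       ≈⟨ ℚᵘ.*≡* (cong (ℤ._* + (suc d ℕ.* suc g)) numerator) ⟩
  mkℚᵘ (+ e) (pred (suc d ℕ.* suc g))     ≈⟨ toℚᵘ-fromℚᵘ (mkℚᵘ (+ e) _) ⟨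
  toℚᵘ (+ e / (suc d ℕ.* suc g))          ∎)
  where
  open ℚᵘ.≃-Reasoning
  r u : ℚ
  r = mkℚ +[1+ n ] d cop
  u = + 1 / suc g
  numerator : +[1+ n ] ℤ.* +[1+ g ] ℤ.+ ℤ.- (+ 1) ℤ.* +[1+ d ] ≡ + e
  numerator = trans (cong (λ m → + m ℤ.+ ℤ.- (+ 1) ℤ.* +[1+ d ]) eq)
    (solve 2 (λ x y → x :+ y :+ (:- con (+ 1)) :* x := y) refl +[1+ d ] (+ e))
    where open ℤ.+-*-Solver

-- Reduction cancels the gcd, so the reduced numerator divides `e`, which is nonzero.
numerator-/-≤ : ∀ e m .{{_ : ℕ.NonZero e}} .{{_ : ℕ.NonZero m}} → ∣ ↥ (+ e / m) ∣ ℕ.≤ e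
numerator-/-≤ e m = ∣⇒≤ (divides ∣ g ∣ (begin
  e                                 ≡⟨ cong ∣_∣ (↥-/ (+ e) m) ⟨
  ∣ ↥ (+ e / m) ℤ.* g ∣             ≡⟨ ℤ.abs-* (↥ (+ e / m)) g ⟩
  ∣ ↥ (+ e / m) ∣ ℕ.* ∣ g ∣         ≡⟨ ℕ.*-comm ∣ ↥ (+ e / m) ∣ ∣ g ∣ ⟩
  ∣ g ∣ ℕ.* ∣ ↥ (+ e / m) ∣         ∎))
  where
  open ≡-Reasoning
  g = ℤ.gcd (+ e) (+ m)

next : (r : ℚ) → .{{Positive r}} → ℚ
next r = r - + 1 / G r

next-mkℚ : ∀ n d .(cop : Coprime (suc n) (suc d)) →
           next (mkℚ +[1+ n ] d cop) ≡ + excess n (suc d) / (suc d ℕ.* suc (suc d ℕ./ suc n))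
next-mkℚ n d cop = trans
  (cong (λ g → mkℚ +[1+ n ] d cop - + 1 / suc g) (ℕ.suc-injective (G-mkℚ n d cop)))
  (mkℚ-1/g n d (suc d ℕ./ suc n) (excess n (suc d)) cop (multiple≡+excess n (suc d)))

next-numerator-≤-excess : ∀ n d .(cop : Coprime (suc n) (suc d)) →
                          ∣ ↥ next (mkℚ +[1+ n ] d cop) ∣ ℕ.≤ excess n (suc d)
next-numerator-≤-excess n d cop =
  subst (λ r → ∣ ↥ r ∣ ℕ.≤ excess n (suc d)) (sym (next-mkℚ n d cop))
    (numerator-/-≤ (excess n (suc d)) _ {{ℕ.>-nonZero (ℕ.m<n⇒0<n∸m (m%n<n (suc d) (suc n)))}})

next-numerator-≤ : ∀ r .{{_ : Positive r}} l → ∣ ↥ r ∣ ℕ.≤ suc l → ∣ ↥ next r ∣ ℕ.≤ suc (pred l)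
next-numerator-≤ (mkℚ +[1+ n ] d cop) l n≤l =
  ℕ.≤-trans (next-numerator-≤-excess n d cop) (excess≤-coprime n (suc d) l (recompute cop) n≤l)

numerator-≤1⇒unitFraction : ∀ r .{{_ : Positive r}} → ∣ ↥ r ∣ ℕ.≤ 1 → ∃[ d ] r ≡ + 1 / suc d
numerator-≤1⇒unitFraction (mkℚ +[1+ zero ] d cop) _ = d , sym (normalize-coprime cop)
numerator-≤1⇒unitFraction (mkℚ +[1+ suc n ] d cop) (s≤s ())

next-unitFraction : ∀ r .{{_ : Positive r}} d → r ≡ + 1 / suc d → next r ≡ + 1 / (suc d ℕ.* suc (suc d))
next-unitFraction r d r≡1/d = begin
  r - + 1 / G r                                ≡⟨ cong (λ g → r - + 1 / suc g) (ℕ.suc-injective (G-unitFraction r d r≡1/d)) ⟩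
  r - + 1 / suc (suc d)                        ≡⟨ cong (_- + 1 / suc (suc d)) (trans r≡1/d (1/n≡mkℚ d)) ⟩
  -- Numerator 1 and greedy denominator `d + 2` leave the new numerator `(d + 2) - (d + 1) = 1`.
  mkℚ (+ 1) d _ - + 1 / suc (suc d)            ≡⟨ mkℚ-1/g 0 d (suc d) 1 (1-coprimeTo (suc d)) (solve 1 (λ x → con 1 :* (con 2 :+ x) := con 1 :+ x :+ con 1) refl d) ⟩
  + 1 / (suc d ℕ.* suc (suc d))                ∎
  where
  open ≡-Reasoning
  open +-*-Solver

next-cong : ∀ {r s} .{{_ : Positive r}} .{{_ : Positive s}} → r ≡ s → next r ≡ next s
next-cong refl = refl

1/-numerator-≤1 : ∀ r .{{_ : Positive r}} .{{_ : NonZero r}} → ∣ ↥ r ∣ ℕ.≤ 1 → 1/ r ≡ + (↧ₙ r) / 1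
1/-numerator-≤1 (mkℚ +[1+ zero ] d cop) _ = sym (normalize-coprime _)
1/-numerator-≤1 (mkℚ +[1+ suc n ] d cop) (s≤s ())

-- Here `1/N` is the remainder before `a` is chosen; substituting `N = a - 1` eliminates it. Working
-- in ℤ avoids truncated subtraction.
recurrence : ∀ {N a a′} → a ≡ suc N → a′ ≡ suc (N ℕ.* suc N) →
             + a′ ≡ (+ a) ℤ.^ 2 ℤ.- + a ℤ.+ + 1
recurrence {N} refl refl = trans (cong ℤ.suc (ℤ.pos-* N (suc N)))
  (solve 1 (λ x → con (+ 1) :+ x :* (con (+ 1) :+ x) := (con (+ 1) :+ x) :^ 2 :- (con (+ 1) :+ x) :+ con (+ 1)) refl (+ N))
  where open ℤ.+-*-Solver

module _ (θ : ℚ) .{{_ : Positive θ}} where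

  remainder : ℕ → ℚ
  remainder m = θ - partialSum θ m

  remainder-suc : ∀ m → remainder (suc m) ≡ next (remainder m) {{remainder-pos θ m}}
  remainder-suc m = trans (cong (λ x → θ + x) (neg-distrib-+ s u)) (sym (+-assoc θ (- s) (- u)))
    where
    s u : ℚ
    s = partialSum θ m
    u = + 1 / 𝒢 θ (suc m)

  -- Each step replaces `l` by `pred l`, so any `k` with `l ≤ k` steps suffice; surplus steps keep
  -- the bound at 1. The starting index `m` grows during the induction.
  remainder-numerator-≤1 : ∀ k l m → ∣ ↥ remainder m ∣ ℕ.≤ suc l → l ℕ.≤ k → ∣ ↥ remainder (k ℕ.+ m) ∣ ℕ.≤ 1
  remainder-numerator-≤1 zero zero m h z≤n = h
  remainder-numerator-≤1 (suc k) l m h l≤k =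
    subst (λ j → ∣ ↥ remainder j ∣ ℕ.≤ 1) (ℕ.+-suc k m)
      (remainder-numerator-≤1 k (pred l) (suc m)
        (subst (λ r → ∣ ↥ r ∣ ℕ.≤ suc (pred l)) (sym (remainder-suc m))
          (next-numerator-≤ (remainder m) {{remainder-pos θ m}} l h))
        (ℕ.pred-mono-≤ l≤k))

  𝒢-suc : ∀ m → ∣ ↥ remainder m ∣ ℕ.≤ 1 →
          + 𝒢 θ (suc (suc m)) ≡ (+ 𝒢 θ (suc m)) ℤ.^ 2 ℤ.- + 𝒢 θ (suc m) ℤ.+ + 1
  𝒢-suc m h = recurrence a≡ a′≡
    where
    unitFraction : ∃[ d ] remainder m ≡ + 1 / suc d
    unitFraction = numerator-≤1⇒unitFraction (remainder m) {{remainder-pos θ m}} h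
    d = proj₁ unitFraction
    r≡1/d = proj₂ unitFraction
    a≡ : 𝒢 θ (suc m) ≡ suc (suc d)
    a≡ = G-unitFraction (remainder m) {{remainder-pos θ m}} d r≡1/d
    r′≡ : remainder (suc m) ≡ + 1 / (suc d ℕ.* suc (suc d))
    r′≡ = trans (remainder-suc m) (next-unitFraction (remainder m) {{remainder-pos θ m}} d r≡1/d)
    a′≡ : 𝒢 θ (suc (suc m)) ≡ suc (suc d ℕ.* suc (suc d))
    a′≡ = G-unitFraction (remainder (suc m)) {{remainder-pos θ (suc m)}} _ r′≡

remainder-numerator-≤1-from : (θ : ℚ) .{{_ : Positive θ}} → ∀ ℓ → ∣ ↥ θ ∣ ∣ ↧ₙ θ ℕ.+ ℓ → ∀ k → ℓ ℕ.≤ k →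
                              ∣ ↥ remainder θ k ∣ ℕ.≤ 1
-- With `ℓ = 0` the numerator divides a coprime denominator, so it is already 1.
remainder-numerator-≤1-from θ@(mkℚ +[1+ n ] d cop) zero c∣d k _ =
  subst (λ j → ∣ ↥ remainder θ j ∣ ℕ.≤ 1) (ℕ.+-identityʳ k)
    (remainder-numerator-≤1 θ k 0 0
      (subst (λ r → ∣ ↥ r ∣ ℕ.≤ 1) (sym (+-identityʳ θ))
        (ℕ.≤-reflexive (coprime-∣⇒≡1 (recompute cop) (subst (suc n ∣_) (ℕ.+-identityʳ (suc d)) c∣d))))
      z≤n)
-- The numerator of `θ` itself may exceed `ℓ`, so the descent starts after one step, at index 1 with
-- bound `suc l`; the other `k` steps cover `l`.
remainder-numerator-≤1-from θ@(mkℚ +[1+ n ] d cop) (suc l) c∣d+ℓ (suc k) (s≤s l≤k) =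
  subst (λ j → ∣ ↥ remainder θ j ∣ ℕ.≤ 1) (ℕ.+-comm k 1)
    (remainder-numerator-≤1 θ k l 1
      (subst (λ r → ∣ ↥ r ∣ ℕ.≤ suc l)
        (sym (trans (remainder-suc θ 0) (next-cong {{remainder-pos θ 0}} (+-identityʳ θ))))
        (ℕ.≤-trans (next-numerator-≤-excess n d cop) (excess≤ n (suc d) l c∣d+ℓ)))
      l≤k)

proposition1p6 : (θ : ℚ) .{{_ : Positive θ}} → θ ≤ 1ℚ →
    (p q : ℕ) .{{_ : ℕ.NonZero p}} .{{_ : ℕ.NonZero q}} → θ ≡ + p / q → gcd p q ≡ 1 →
    (ℓ : ℕ) → IsLeast (λ j → p ∣ (q ℕ.+ j)) ℓ →
    (∃[ k ] (ℕ.NonZero k × (1/ (θ - partialSum θ ℓ)) {{remainder-nonZero θ ℓ}} ≡ + k / 1))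
    × ((n : ℕ) .{{_ : ℕ.NonZero n}} → suc ℓ ℕ.≤ n →
    + 𝒢 θ (suc n) ≡ (+ 𝒢 θ n) ℤ.^ 2 ℤ.- + 𝒢 θ n ℤ.+ + 1)
proposition1p6 θ _ p q@(suc q-1) θ≡p/q gcd≡1 ℓ (p∣q+ℓ , _) =
  -- The remainder has reduced numerator 1, so its reciprocal is its denominator.
  (↧ₙ remainder θ ℓ , _ , 1/-numerator-≤1 (remainder θ ℓ) {{remainder-pos θ ℓ}} {{remainder-nonZero θ ℓ}} (unit ℓ ℕ.≤-refl)) ,
  -- The term of index `suc m` is chosen from the remainder after `m` terms, which turns `ℓ + 1 ≤ n`
  -- into `ℓ ≤ m`.
  λ { (suc m) (s≤s ℓ≤m) → 𝒢-suc θ m (unit m ℓ≤m) }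
  where
  -- Coprimality identifies `p` and `q` with the stored numerator and denominator of `θ`.
  θ≡mkℚ : θ ≡ mkℚ (+ p) q-1 (gcd≡1⇒coprime gcd≡1)
  θ≡mkℚ = trans θ≡p/q (normalize-coprime (gcd≡1⇒coprime gcd≡1))
  unit : ∀ k → ℓ ℕ.≤ k → ∣ ↥ remainder θ k ∣ ℕ.≤ 1
  unit = remainder-numerator-≤1-from θ ℓ
    (subst (λ r → ∣ ↥ r ∣ ∣ ↧ₙ r ℕ.+ ℓ) (sym θ≡mkℚ) p∣q+ℓ)
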